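{- Let $G_1=(V_1,E_1)$ and $G_2=(V_2,E_2)$ be finite simple graphs with disjoint vertex sets and with $|V_i|=n_i\geq 1$ for $i=1,2$, and set $$B=\left\lceil\frac{n_1n_2}{n_1+n_2-1}\right\rceil-1.$$ Then $$\max\{\operatorname{arb}(G_1),\operatorname{arb}(G_2),B\}\leq\operatorname{arb}(G_1* G_2)\leq\operatorname{arb}(G_1)+\operatorname{arb}(G_2)+B+1,$$ where $G_1*G_2$ is the join of $G_1$ and $G_2$ and $\operatorname{arb}$ denotes the reduced arboricity.
   Context: All graphs are finite and simple. A forest is a graph containing no cycles. Reduced arboricity: for a graph $G$ with $E(G)\neq\varnothing$, let $k$ be the minimum number of forests whose edge sets partition $E(G)$, and set $\operatorname{arb}(G)=k-1$ (so it is one less than the classical arboricity). If $E(G)=\varnothing$, set $\operatorname{arb}(G)=0$. Join: for graphs $G_1=(V_1,E_1)$ and $G_2=(V_2,E_2)$ with disjoint vertex sets, the join $G_1*G_2$ is the graph with vertex set $V_1\cup V_2$ and edge set $E_1\cup E_2\cup\{uv: u\in V_1,\ v\in V_2\}$. -}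

module Defs where

open import Data.Bool using (Bool; true; false; T; T?)
open import Data.Empty using (⊥)
open import Data.Fin using (Fin; zero; suc; toℕ)
import Data.Fin.Properties as Fin
open import Data.Integer as ℤ using (ℤ; 1ℤ)
open import Data.List using (List; []; _∷_; _∷ʳ_; length; lookup)
open import Data.List.Membership.Propositional.Properties using (∈-lookup)
open import Data.List.Relation.Unary.All as All using ([]; _∷_)
open import Data.List.Relation.Unary.AllPairs using ([]; _∷_)
open import Data.List.Relation.Unary.Linked as Linked using (Linked; [-]; _∷_; linked?)
open import Data.List.Relation.Unary.Unique.Propositional using (Unique)
import Data.List.Relation.Unary.Unique.DecPropositional as DecUnique
open import Data.Nat
  using (ℕ; zero; suc; _+_; _*_; _∸_; _⊓_; _≤_; _≤?_; z≤n; s≤s; NonZero; nonZero)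
import Data.Nat.Properties as ℕ
open import Data.Product using (∃; ∃-syntax; Σ-syntax; _×_; _,_; proj₁; proj₂)
open import Data.Rational using (ceiling; _/_)
open import Data.Sum using (_⊎_; inj₁; inj₂)
open import Data.Sum.Function.Propositional using (_⊎-↔_)
open import Data.Unit using (⊤)
open import Data.Vec as Vec using (Vec; []; _∷_)
open import Data.Vec.Properties using (lookup∘tabulate)
open import Function using (_∘_; _↔_; Inverse)
import Function.Construct.Composition as Compose
import Function.Construct.Symmetry as Symmetry
open import Level using (Level; 0ℓ)
open import Relation.Binary using (Rel; Symmetric; Irreflexive; Decidable)
open import Relation.Binary.PropositionalEquality
  using (_≡_; _≢_; refl; sym; trans; cong; cong₂; subst; ≢-sym)
open import Relation.Nullary using (¬_; Dec; yes; no; isYes; contradiction)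
open import Relation.Nullary.Decidable
  using (map′; _×-dec_; _→-dec_; ¬?; toWitness; fromWitness)
open import Relation.Unary using (Pred) renaming (Decidable to Decidable₁)

private variable
  ℓ : Level
  A V V₁ V₂ : Set

record SimpleGraph (V : Set) : Set₁ where
  infix 4 _~_ _~?_
  field
    _~_      : Rel V 0ℓ
    ~-sym    : Symmetric _~_
    ~-irrefl : Irreflexive _≡_ _~_
    _~?_     : Decidable _~_

record FiniteGraph : Set₁ where
  field
    Vertex : Set
    order  : ℕ
    enum   : Vertex ↔ Fin order
    graph  : SimpleGraph Vertex

open SimpleGraph
open FiniteGraph

-- Taking the vertex set to be V₁ ⊎ V₂ makes the two vertex sets disjoint.

module _ (G : SimpleGraph V₁) (H : SimpleGraph V₂) where

  JoinAdj : Rel (V₁ ⊎ V₂) 0ℓ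
  JoinAdj (inj₁ u) (inj₁ v) = _~_ G u v
  JoinAdj (inj₁ _) (inj₂ _) = ⊤
  JoinAdj (inj₂ _) (inj₁ _) = ⊤
  JoinAdj (inj₂ u) (inj₂ v) = _~_ H u v

  joinSimple : SimpleGraph (V₁ ⊎ V₂)
  joinSimple ._~_ = JoinAdj
  joinSimple .~-sym {inj₁ _} {inj₁ _} = ~-sym G
  joinSimple .~-sym {inj₁ _} {inj₂ _} = _
  joinSimple .~-sym {inj₂ _} {inj₁ _} = _
  joinSimple .~-sym {inj₂ _} {inj₂ _} = ~-sym H
  joinSimple .~-irrefl {inj₁ _} refl = ~-irrefl G refl
  joinSimple .~-irrefl {inj₂ _} refl = ~-irrefl H refl
  joinSimple ._~?_ (inj₁ u) (inj₁ v) = _~?_ G u v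
  joinSimple ._~?_ (inj₁ _) (inj₂ _) = yes _
  joinSimple ._~?_ (inj₂ _) (inj₁ _) = yes _
  joinSimple ._~?_ (inj₂ u) (inj₂ v) = _~?_ H u v

join : FiniteGraph → FiniteGraph → FiniteGraph
join G H .Vertex = Vertex G ⊎ Vertex H
join G H .order  = order G + order H
join G H .enum   =
  Compose.inverse (enum G ⊎-↔ enum H) (Symmetry.inverse Fin.+↔⊎)
join G H .graph  = joinSimple (graph G) (graph H)

-- The list v ∷ vs is the sequence of vertices of a cycle, without
-- repetition of the starting point.

IsCycle : SimpleGraph V → V → List V → Set
IsCycle G v vs =
  2 ≤ length vs × Unique (v ∷ vs) × Linked (_~_ G) (v ∷ vs ∷ʳ v)

IsForest : SimpleGraph V → Set
IsForest G = ∀ v vs → ¬ IsCycle G v vs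

record PartitionsEdges {k} (F : Fin k → SimpleGraph V) (G : SimpleGraph V) : Set where
  field
    within   : ∀ {i u v} → _~_ (F i) u v → _~_ G u v
    covers   : ∀ {u v} → _~_ G u v → ∃[ i ] _~_ (F i) u v
    disjoint : ∀ {i j u v} → _~_ (F i) u v → _~_ (F j) u v → i ≡ j

open PartitionsEdges

-- The forests all live on the vertex set of G; this is no restriction, as
-- isolated vertices affect neither acyclicity nor the edge sets.

ForestPartition : SimpleGraph V → ℕ → Set₁
ForestPartition {V} G k =
  Σ[ F ∈ (Fin k → SimpleGraph V) ] (∀ i → IsForest (F i)) × PartitionsEdges F G

-- The definition of arb requires that the least k with ForestPartition G k
-- exists, which constructively takes an upper bound and a decision procedure.

IsLeast : Pred ℕ ℓ → Pred ℕ ℓ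
IsLeast P k = P k × (∀ j → P j → k ≤ j)

least : {P : Pred ℕ ℓ} → Decidable₁ P → ∀ n → P n → ∃ (IsLeast P)
least P? zero    p = 0 , p , λ _ _ → z≤n
least P? (suc n) p with P? 0
... | yes p₀ = 0 , p₀ , λ _ _ → z≤n
... | no ¬p₀ with least (P? ∘ suc) n p
...   | k , pₖ , k≤ = suc k , pₖ , λ where
        zero    p₀ → contradiction p₀ ¬p₀
        (suc j) pⱼ → s≤s (k≤ j pⱼ)

module Search where

  Searchable : Set → Set₁
  Searchable A = {P : A → Set} → (∀ x → Dec (P x)) → Dec (∃ P)

  bool-search : Searchable Bool
  bool-search P? with P? true | P? false
  ... | yes p | _     = yes (true , p)
  ... | no _  | yes q = yes (false , q)
  ... | no ¬p | no ¬q = no λ { (true , p) → ¬p p ; (false , q) → ¬q q }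

  vec-search : Searchable A → ∀ n → Searchable (Vec A n)
  vec-search s zero    P? = map′ ([] ,_) (λ { ([] , p) → p }) (P? [])
  vec-search s (suc n) P? = map′
    (λ { (x , xs , p) → x ∷ xs , p })
    (λ { (x ∷ xs , p) → x , xs , p })
    (s λ x → vec-search s n λ xs → P? (x ∷ xs))

  lookup-injective : {xs : List A} → Unique xs → ∀ i j → lookup xs i ≡ lookup xs j → i ≡ j
  lookup-injective (_ ∷ _)  zero    zero    _  = refl
  lookup-injective (x∉ ∷ _) zero    (suc j) eq = contradiction eq (All.lookup x∉ (∈-lookup j))
  lookup-injective (x∉ ∷ _) (suc i) zero    eq = contradiction (sym eq) (All.lookup x∉ (∈-lookup i))
  lookup-injective (_ ∷ u)  (suc i) (suc j) eq = cong suc (lookup-injective u i j eq)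

  module _ {n} (e : V ↔ Fin n) where

    open Inverse e using (to; from; strictlyInverseˡ; strictlyInverseʳ)

    to-injective : ∀ {u v} → to u ≡ to v → u ≡ v
    to-injective {u} {v} eq =
      trans (sym (strictlyInverseʳ u)) (trans (cong from eq) (strictlyInverseʳ v))

    _≟_ : Decidable {A = V} _≡_
    u ≟ v = map′ to-injective (cong to) (to u Fin.≟ to v)

    search : Searchable V
    search {P} P? = map′
      (λ (i , p) → from i , p)
      (λ (v , p) → to v , subst P (sym (strictlyInverseʳ v)) p)
      (Fin.any? (P? ∘ from))

    all? : {P : V → Set} → (∀ v → Dec (P v)) → Dec (∀ v → P v)
    all? {P} P? = map′
      (λ f v → subst P (strictlyInverseʳ v) (f (to v)))
      (_∘ from)
      (Fin.all? (P? ∘ from))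

    list-search : ∀ m {P : List V → Set} → (∀ vs → Dec (P vs)) →
                  Dec (∃[ vs ] length vs ≤ m × P vs)
    list-search zero P? = map′
      (λ p → [] , z≤n , p) (λ { ([] , _ , p) → p }) (P? [])
    list-search (suc m) P?
      with P? [] | search (λ v → list-search m (λ vs → P? (v ∷ vs)))
    ... | yes p | _ = yes ([] , z≤n , p)
    ... | no _  | yes (v , vs , ≤m , p) = yes (v ∷ vs , s≤s ≤m , p)
    ... | no ¬p | no ¬q = no λ where
      ([] , _ , p)          → ¬p p
      (v ∷ vs , s≤s ≤m , p) → ¬q (v , vs , ≤m , p)

    unique⇒short : ∀ {vs} → Unique vs → length vs ≤ n
    unique⇒short {vs} u =
      Fin.injective⇒≤ {f = to ∘ lookup vs} (lookup-injective u _ _ ∘ to-injective)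

    isCycle? : ∀ (G : SimpleGraph V) v vs → Dec (IsCycle G v vs)
    isCycle? G v vs =
      2 ≤? length vs ×-dec DecUnique.unique? _≟_ (v ∷ vs) ×-dec linked? (_~?_ G) _

    isForest? : ∀ (G : SimpleGraph V) → Dec (IsForest G)
    isForest? G = map′
      (λ ¬c v vs c@(_ , u , _) → ¬c (v , vs , ℕ.<⇒≤ (unique⇒short u) , c))
      (λ f (v , vs , _ , c) → f v vs c)
      (¬? (search λ v → list-search n (isCycle? G v)))

    partitionsEdges? : ∀ {k} (F : Fin k → SimpleGraph V) G → Dec (PartitionsEdges F G)
    partitionsEdges? F G = map′
      (λ (w , c , d) → record
        { within   = λ {i} {u} {v} → w i u v
        ; covers   = λ {u} {v} → c u v
        ; disjoint = λ {i} {j} {u} {v} → d i j u v })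
      (λ p → (λ _ _ _ → within p) , (λ _ _ → covers p) , (λ _ _ _ _ → disjoint p))
      ( (Fin.all? λ i → all? λ u → all? λ v → _~?_ (F i) u v →-dec _~?_ G u v)
      ×-dec (all? λ u → all? λ v → _~?_ G u v →-dec Fin.any? λ i → _~?_ (F i) u v)
      ×-dec (Fin.all? λ i → Fin.all? λ j → all? λ u → all? λ v →
              _~?_ (F i) u v →-dec _~?_ (F j) u v →-dec i Fin.≟ j))

    -- Symmetrising and removing the diagonal turns every Boolean matrix into
    -- a simple graph, and every simple graph on V arises in this way.

    Matrix : Set
    Matrix = Vec (Vec Bool n) n

    entry : Matrix → V → V → Bool
    entry M u v = Vec.lookup (Vec.lookup M (to u)) (to v)

    fromMatrix : Matrix → SimpleGraph V
    fromMatrix M ._~_ u v = T (entry M u v) × T (entry M v u) × u ≢ v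
    fromMatrix M .~-sym (p , q , u≢v) = q , p , ≢-sym u≢v
    fromMatrix M .~-irrefl u≡v (_ , _ , u≢v) = u≢v u≡v
    fromMatrix M ._~?_ u v = T? _ ×-dec T? _ ×-dec ¬? (u ≟ v)

    toMatrix : SimpleGraph V → Matrix
    toMatrix G = Vec.tabulate λ i → Vec.tabulate λ j → isYes (_~?_ G (from i) (from j))

    entry-toMatrix : ∀ G u v → entry (toMatrix G) u v ≡ isYes (_~?_ G u v)
    entry-toMatrix G u v =
      trans (cong (λ r → Vec.lookup r (to v)) (lookup∘tabulate _ (to u)))
      (trans (lookup∘tabulate _ (to v))
        (cong₂ (λ x y → isYes (_~?_ G x y)) (strictlyInverseʳ u) (strictlyInverseʳ v)))

    ~⇒entry : ∀ G {u v} → _~_ G u v → T (entry (toMatrix G) u v)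
    ~⇒entry G {u} {v} a = subst T (sym (entry-toMatrix G u v)) (fromWitness {a? = _~?_ G u v} a)

    to-matrix : ∀ G {u v} → _~_ G u v → _~_ (fromMatrix (toMatrix G)) u v
    to-matrix G a = ~⇒entry G a , ~⇒entry G (~-sym G a) , λ u≡v → ~-irrefl G u≡v a

    from-matrix : ∀ G {u v} → _~_ (fromMatrix (toMatrix G)) u v → _~_ G u v
    from-matrix G {u} {v} (p , _) =
      toWitness {a? = _~?_ G u v} (subst T (entry-toMatrix G u v) p)

    forestPartition? : ∀ G k → Dec (ForestPartition G k)
    forestPartition? G k = map′
      (λ (Ms , p) → fromMatrix ∘ Vec.lookup Ms , p)
      (λ (F , f , p) → Vec.tabulate (toMatrix ∘ F) ,
        let eq   = lookup∘tabulate (toMatrix ∘ F)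
            back : ∀ i {u v} → _~_ (fromMatrix (Vec.lookup (Vec.tabulate (toMatrix ∘ F)) i)) u v →
                   _~_ (F i) u v
            back i {u} {v} a =
              from-matrix (F i) (subst (λ M → _~_ (fromMatrix M) u v) (eq i) a)
            forth : ∀ i {u v} → _~_ (F i) u v →
                    _~_ (fromMatrix (Vec.lookup (Vec.tabulate (toMatrix ∘ F)) i)) u v
            forth i {u} {v} a =
              subst (λ M → _~_ (fromMatrix M) u v) (sym (eq i)) (to-matrix (F i) a)
        in (λ i v vs (l , u , c) → f i v vs (l , u , Linked.map (back i) c))
         , record
             { within   = λ {i} → within p ∘ back i
             ; covers   = λ a → let (i , b) = covers p a in i , forth i b
             ; disjoint = λ {i} {j} a b → disjoint p (back i a) (back j b) })
      (vec-search (vec-search (vec-search bool-search n) n) k λ Ms →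
        (Fin.all? λ i → isForest? (fromMatrix (Vec.lookup Ms i)))
        ×-dec partitionsEdges? (fromMatrix ∘ Vec.lookup Ms) G)

    -- Assigning each edge to its smaller endpoint partitions G into n stars.

    module _ (G : SimpleGraph V) where

      lower : V → V → ℕ
      lower u v = toℕ (to u) ⊓ toℕ (to v)

      star : Fin n → SimpleGraph V
      star i ._~_ u v = _~_ G u v × lower u v ≡ toℕ i
      star i .~-sym {u} {v} (a , eq) = ~-sym G a , trans (ℕ.⊓-comm (toℕ (to v)) _) eq
      star i .~-irrefl eq (a , _) = ~-irrefl G eq a
      star i ._~?_ u v = _~?_ G u v ×-dec (lower u v ℕ.≟ toℕ i)

      centre : ∀ {i u v} → _~_ (star i) u v → to u ≡ i ⊎ to v ≡ i
      centre {i} {u} {v} (_ , eq) with ℕ.⊓-sel (toℕ (to u)) (toℕ (to v))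
      ... | inj₁ p = inj₁ (Fin.toℕ-injective (trans (sym p) eq))
      ... | inj₂ p = inj₂ (Fin.toℕ-injective (trans (sym p) eq))

      same : ∀ {i u v} → to u ≡ i → to v ≡ i → u ≡ v
      same p q = to-injective (trans p (sym q))

      -- No star contains a path with three edges, or a triangle.
      no-P₄ : ∀ {i a b c d} → a ≢ b → a ≢ c → b ≢ c → b ≢ d →
              _~_ (star i) a b → _~_ (star i) b c → _~_ (star i) c d → ⊥
      no-P₄ a≢b a≢c b≢c b≢d ab bc cd with centre ab | centre bc | centre cd
      ... | inj₁ p | inj₁ q | _      = a≢b (same p q)
      ... | inj₁ p | inj₂ q | _      = a≢c (same p q)
      ... | inj₂ p | _      | inj₁ r = b≢c (same p r)
      ... | inj₂ p | _      | inj₂ r = b≢d (same p r)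

      star-isForest : ∀ i → IsForest (star i)
      star-isForest i _ [] (() , _)
      star-isForest i _ (_ ∷ []) (s≤s () , _)
      star-isForest i a (b ∷ c ∷ [])
        (_ , (a≢b ∷ a≢c ∷ []) ∷ (b≢c ∷ []) ∷ _ , ab ∷ bc ∷ ca ∷ [-]) =
        no-P₄ a≢b a≢c b≢c (≢-sym a≢b) ab bc ca
      star-isForest i a (b ∷ c ∷ d ∷ _)
        (_ , (a≢b ∷ a≢c ∷ _) ∷ (b≢c ∷ b≢d ∷ _) ∷ _ , ab ∷ bc ∷ cd ∷ _) =
        no-P₄ a≢b a≢c b≢c b≢d ab bc cd

      stars-partition : PartitionsEdges star G
      stars-partition .within = proj₁
      stars-partition .covers {u} {v} a with ℕ.⊓-sel (toℕ (to u)) (toℕ (to v))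
      ... | inj₁ p = to u , a , p
      ... | inj₂ p = to v , a , p
      stars-partition .disjoint (_ , p) (_ , q) = Fin.toℕ-injective (trans (sym p) q)

      stars : ForestPartition G n
      stars = star , star-isForest , stars-partition

forestNumber : ∀ G → ∃ (IsLeast (ForestPartition (graph G)))
forestNumber G =
  least (Search.forestPartition? (enum G) (graph G)) (order G) (Search.stars (enum G) (graph G))

-- An edgeless graph is partitioned by the empty family of forests, and
-- 0 ∸ 1 = 0 is then the prescribed value.

arb : FiniteGraph → ℕ
arb G = proj₁ (forestNumber G) ∸ 1

arb-edgeless : ∀ G → (∀ u v → ¬ _~_ (graph G) u v) → arb G ≡ 0
arb-edgeless G none = cong (_∸ 1) (ℕ.n≤0⇒n≡0 (proj₂ (proj₂ (forestNumber G)) 0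
  ((λ ()) , (λ ()) , record
    { within   = λ { {()} }
    ; covers   = λ a → contradiction a (none _ _)
    ; disjoint = λ { {()} } })))

order-nonZero : ∀ n₁ n₂ .{{_ : NonZero n₁}} .{{_ : NonZero n₂}} → NonZero (n₁ + n₂ ∸ 1)
order-nonZero (suc zero)     (suc _) = nonZero
order-nonZero (suc (suc _))  (suc _) = nonZero

B : ∀ n₁ n₂ .{{_ : NonZero n₁}} .{{_ : NonZero n₂}} → ℤ
B n₁ n₂ = ceiling (ℤ.+ (n₁ * n₂) / (n₁ + n₂ ∸ 1)) ℤ.- 1ℤ
  where instance _ = order-nonZero n₁ n₂

-- Let a = ⌈n₁n₂/(n₁+n₂−1)⌉.  A forest on n₁ + n₂ vertices has at most
-- n₁ + n₂ − 1 edges, so the n₁n₂ cross edges of the join need at least a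
-- forests; together with restriction to G₁ and G₂ this is the lower bound.
-- For the upper bound, forests of G₁ and G₂ can be paired up since they share
-- no vertex, so it is enough to split the complete bipartite graph into a
-- forests.  Write n₁ = a + d.  Row r and column c are joined in colour i when
-- i n₁ + c d ≤ a x < i n₁ + c d + n₁ for x = r or x = r + n₁.  With rows
-- placed at x rather than r, consecutive columns of one colour occupy intervals
-- of rows overlapping in at most one row, so each colour class is a staircase.

module Submission where

module ForestPartitions where
  open import Defs
  open import Data.Nat
  import Data.Nat.Properties as ℕ
  open import Data.Nat.DivMod using (m≡m%n+[m/n]*n; m%n<n; m/n*n≤m)
  open import Data.Nat.Tactic.RingSolver using (solve-∀)
  open import Data.Empty using (⊥)
  open import Data.Unit using (⊤; tt)
  open import Data.Fin as Fin
    using (Fin; zero; suc; toℕ; fromℕ<; splitAt; _↑ˡ_; _↑ʳ_; punchOut; remQuot; combine)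
  import Data.Fin.Properties as Fin
  open import Data.List using (List; []; _∷_; _++_; _∷ʳ_; length; map; filter; allFin)
  open import Data.List.Properties using (length-map; map-++; length-tabulate)
  open import Data.List.Membership.Propositional using (_∈_)
  import Data.List.Membership.DecPropositional as DecMembership
  open import Data.List.Relation.Unary.Any using (here; there)
  open import Data.List.Relation.Unary.All as All using (All; []; _∷_)
  import Data.List.Relation.Unary.All.Properties as All
  open import Data.List.Relation.Unary.AllPairs as AllPairs using (AllPairs; []; _∷_)
  import Data.List.Relation.Unary.AllPairs.Properties as AllPairs
  open import Data.List.Relation.Unary.Linked as Linked using (Linked; []; [-]; _∷_)
  import Data.List.Relation.Unary.Linked.Properties as Linked
  open import Data.List.Relation.Unary.Unique.Propositional using (Unique)
  import Data.List.Relation.Unary.Unique.Propositional.Properties as Unique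
  open import Data.Product using (Σ; ∃-syntax; _×_; _,_; proj₁; proj₂)
  open import Data.Sum as Sum using (_⊎_; inj₁; inj₂; [_,_]; [_,_]′)
  open import Data.Sum.Properties using (inj₁-injective; inj₂-injective)
  open import Function using (_∘_; _$_; _↔_; Inverse; id)
  open import Level using (0ℓ)
  open import Relation.Binary using (Rel; Decidable; _⇒_; tri<; tri≈; tri>)
  open import Relation.Binary.Construct.Closure.ReflexiveTransitive as Star using (Star; ε; _◅_; _◅◅_)
  open import Relation.Binary.PropositionalEquality
    using (_≡_; _≢_; refl; sym; trans; cong; cong₂; subst; ≢-sym; module ≡-Reasoning)
  open import Relation.Nullary using (¬_; Dec; yes; no; contradiction)
  open import Relation.Nullary.Decidable using (¬?)
  open import Relation.Unary using (Pred) renaming (Decidable to Decidable₁)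

  open SimpleGraph
  open PartitionsEdges

  private variable
    V V₁ V₂ : Set

  -- Acyclicity from a ranking of the vertices.

  -- A walk without backtracking that has risen once can only go on rising, so
  -- both edges of a cycle at its starting point would lead downwards.

  module _ (G : SimpleGraph V) (rank : V → ℕ)
    (unique-lower : ∀ {u v w} → _~_ G u v → _~_ G u w →
                    rank v ≤ rank u → rank w ≤ rank u → v ≡ w) where

    peak : ∀ {u v w} → _~_ G u v → _~_ G v w → u ≢ w → rank u ≤ rank v → rank v < rank w
    peak {u} {v} {w} uv vw u≢w u≤v =
      ℕ.≰⇒> λ w≤v → u≢w (unique-lower (~-sym G uv) vw u≤v w≤v)

    climb : ∀ {u v w} ws → Unique (u ∷ w ∷ ws) → All (v ≢_) (u ∷ w ∷ ws) →
            _~_ G u w → Linked (_~_ G) (w ∷ ws ∷ʳ v) → rank u ≤ rank w → rank w < rank v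
    climb [] _ (v≢u ∷ _) uw (wv ∷ [-]) u≤w = peak uw wv (≢-sym v≢u) u≤w
    climb (x ∷ ws) ((_ ∷ u≢x ∷ _) ∷ uniq) (_ ∷ v∉) uw (wx ∷ l) u≤w =
      let w<x = peak uw wx u≢x u≤w
      in ℕ.<-trans w<x (climb ws uniq v∉ wx l (ℕ.<⇒≤ w<x))

    -- Induction from the far end: if the last edge falls into `v`, then `peak` read backwards
    -- forces every earlier edge to fall as well. Otherwise the last vertex before `v` is the
    -- required `z`.
    descend-or-end-low : ∀ {u v w} ws → Unique (u ∷ w ∷ ws) → All (v ≢_) (u ∷ w ∷ ws) →
      _~_ G u w → Linked (_~_ G) (w ∷ ws ∷ʳ v) →
      (rank w < rank u × rank v ≤ rank w) ⊎ (∃[ z ] z ∈ w ∷ ws × _~_ G z v × rank z ≤ rank v)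
    descend-or-end-low {u} {v} {w} [] _ (v≢u ∷ _) uw (wv ∷ [-]) with rank w ≤? rank v
    ... | yes w≤v = inj₂ (w , here refl , wv , w≤v)
    ... | no w≰v = inj₁
      (ℕ.≰⇒> (λ u≤w → w≰v (ℕ.<⇒≤ (peak uw wv (≢-sym v≢u) u≤w))) , ℕ.<⇒≤ (ℕ.≰⇒> w≰v))
    descend-or-end-low {u} {v} {w} (x ∷ ws) ((_ ∷ u≢x ∷ _) ∷ uniq) (_ ∷ v∉) uw (wx ∷ l)
      with descend-or-end-low ws uniq v∉ wx l
    ... | inj₂ (z , z∈ , zv , z≤v) = inj₂ (z , there z∈ , zv , z≤v)
    ... | inj₁ (x<w , v≤x) = inj₁
      (ℕ.≰⇒> (λ u≤w → ℕ.<-asym x<w (peak uw wx u≢x u≤w)) , ℕ.≤-trans v≤x (ℕ.<⇒≤ x<w))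

    rank⇒forest : IsForest G
    rank⇒forest v [] (() , _)
    rank⇒forest v (_ ∷ []) (s≤s () , _)
    rank⇒forest v (x ∷ y ∷ zs) (_ , v∉@(_ ∷ v≢y ∷ _) ∷ uniq@(x∉ ∷ _) , vx ∷ xy ∷ l)
      with rank v ≤? rank x | descend-or-end-low zs uniq v∉ xy l
    -- A first edge that does not fall makes the whole walk rise, which gives `x < y < v ≤ x` in
    -- rank.
    ... | yes v≤x | _ =
      let x<y = peak vx xy v≢y v≤x
      in ℕ.<-irrefl refl (ℕ.<-≤-trans (ℕ.<-trans x<y (climb zs uniq v∉ xy l (ℕ.<⇒≤ x<y))) v≤x)
    ... | no v≰x | inj₁ (y<x , v≤y) = v≰x (ℕ.≤-trans v≤y (ℕ.<⇒≤ y<x))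
    -- Both ends of the cycle now lead down from `v`, so the hypothesis identifies `x` with `z`,
    -- which occurs later in a list without repetition.
    ... | no v≰x | inj₂ (z , z∈ , zv , z≤v) =
      All.lookup x∉ z∈ (unique-lower vx (~-sym G zv) (ℕ.<⇒≤ (ℕ.≰⇒> v≰x)) z≤v)

  -- Forest partitions under restriction, disjoint union and edge-disjoint union.

  comap : (V₁ → V₂) → SimpleGraph V₂ → SimpleGraph V₁
  comap f G ._~_ u v = _~_ G (f u) (f v)
  comap f G .~-sym = ~-sym G
  comap f G .~-irrefl refl = ~-irrefl G refl
  comap f G ._~?_ u v = _~?_ G (f u) (f v)

  module _ (f : V₁ → V₂) (G : SimpleGraph V₂) where

    isCycle-map⁺ : (∀ {u v} → f u ≡ f v → u ≡ v) → ∀ {v vs} →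
                   IsCycle (comap f G) v vs → IsCycle G (f v) (map f vs)
    isCycle-map⁺ inj {v} {vs} (len , uniq , l) =
      subst (2 ≤_) (sym (length-map f vs)) len ,
      Unique.map⁺ inj uniq ,
      subst (Linked (_~_ G)) (cong (f v ∷_) (map-++ f vs (v ∷ []))) (Linked.map⁺ l)

    isCycle-map⁻ : ∀ {v vs} → IsCycle G (f v) (map f vs) → IsCycle (comap f G) v vs
    isCycle-map⁻ {v} {vs} (len , uniq , l) =
      subst (2 ≤_) (length-map f vs) len ,
      Unique.map⁻ uniq ,
      Linked.map⁻ (subst (Linked (_~_ G)) (sym (cong (f v ∷_) (map-++ f vs (v ∷ [])))) l)

    comap-isForest : (∀ {u v} → f u ≡ f v → u ≡ v) → IsForest G → IsForest (comap f G)
    comap-isForest inj forest v vs c = forest (f v) (map f vs) (isCycle-map⁺ inj c)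

  -- The two implications make `G` an induced subgraph of `H` along `f`, so the forests of `H` can
  -- simply be restricted. This is applied to the two sides of a join.
  comap-partition : ∀ (f : V₁ → V₂) → (∀ {u v} → f u ≡ f v → u ≡ v) →
    ∀ {G H} → (∀ {u v} → _~_ G u v → _~_ H (f u) (f v)) → (∀ {u v} → _~_ H (f u) (f v) → _~_ G u v) →
    ∀ {k} → ForestPartition H k → ForestPartition G k
  comap-partition f inj G⇒H H⇒G (F , forest , p) =
    comap f ∘ F , (λ i → comap-isForest f (F i) inj (forest i)) , record
      { within = H⇒G ∘ within p ; covers = covers p ∘ G⇒H ; disjoint = disjoint p }

  infixr 6 _⊕_

  _⊕_ : SimpleGraph V₁ → SimpleGraph V₂ → SimpleGraph (V₁ ⊎ V₂)
  (G ⊕ H) ._~_ (inj₁ u) (inj₁ v) = _~_ G u v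
  (G ⊕ H) ._~_ (inj₂ u) (inj₂ v) = _~_ H u v
  (G ⊕ H) ._~_ _        _        = ⊥
  (G ⊕ H) .~-sym {inj₁ _} {inj₁ _} = ~-sym G
  (G ⊕ H) .~-sym {inj₂ _} {inj₂ _} = ~-sym H
  (G ⊕ H) .~-irrefl {inj₁ _} refl = ~-irrefl G refl
  (G ⊕ H) .~-irrefl {inj₂ _} refl = ~-irrefl H refl
  (G ⊕ H) ._~?_ (inj₁ u) (inj₁ v) = _~?_ G u v
  (G ⊕ H) ._~?_ (inj₂ u) (inj₂ v) = _~?_ H u v
  (G ⊕ H) ._~?_ (inj₁ _) (inj₂ _) = no λ ()
  (G ⊕ H) ._~?_ (inj₂ _) (inj₁ _) = no λ ()

  module _ (G : SimpleGraph V₁) (H : SimpleGraph V₂) where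

    -- No edge changes sides. The list `ws` leaves room for the closing vertex of a cycle, since
    -- `vs ∷ʳ v` is `vs ++ v ∷ []`.
    stays-left : ∀ {v} vs {ws} → Linked (_~_ (G ⊕ H)) (inj₁ v ∷ vs ++ ws) →
                 ∃[ us ] vs ≡ map inj₁ us
    stays-left [] _ = [] , refl
    stays-left (inj₁ u ∷ vs) (_ ∷ l) with us , refl ← stays-left vs l = u ∷ us , refl
    stays-left (inj₂ u ∷ vs) (() ∷ _)

    stays-right : ∀ {v} vs {ws} → Linked (_~_ (G ⊕ H)) (inj₂ v ∷ vs ++ ws) →
                  ∃[ us ] vs ≡ map inj₂ us
    stays-right [] _ = [] , refl
    stays-right (inj₁ u ∷ vs) (() ∷ _)
    stays-right (inj₂ u ∷ vs) (_ ∷ l) with us , refl ← stays-right vs l = u ∷ us , refl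

    ⊕-isForest : IsForest G → IsForest H → IsForest (G ⊕ H)
    ⊕-isForest f g (inj₁ v) vs c@(_ , _ , l) with us , refl ← stays-left vs l =
      f v us (isCycle-map⁻ inj₁ (G ⊕ H) c)
    ⊕-isForest f g (inj₂ v) vs c@(_ , _ , l) with us , refl ← stays-right vs l =
      g v us (isCycle-map⁻ inj₂ (G ⊕ H) c)

  -- Forests on disjoint vertex sets can share a colour, so the two sides together still cost `k`
  -- colours rather than `2 * k`.
  ⊕-partition : ∀ {G : SimpleGraph V₁} {H : SimpleGraph V₂} {k} →
                ForestPartition G k → ForestPartition H k → ForestPartition (G ⊕ H) k
  ⊕-partition {V₁} {V₂} {G = G} {H} {k} (F , f , p) (F′ , f′ , p′) =
    (λ i → F i ⊕ F′ i) , (λ i → ⊕-isForest (F i) (F′ i) (f i) (f′ i)) , record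
      { within   = λ {i} {u} {v} → w {i} u v
      ; covers   = λ {u} {v} → c u v
      ; disjoint = λ {i} {j} {u} {v} → d {i} {j} u v
      }
    where
    w : ∀ {i} u v → _~_ (F i ⊕ F′ i) u v → _~_ (G ⊕ H) u v
    w (inj₁ _) (inj₁ _) = within p
    w (inj₂ _) (inj₂ _) = within p′
    c : ∀ u v → _~_ (G ⊕ H) u v → ∃[ i ] _~_ (F i ⊕ F′ i) u v
    c (inj₁ _) (inj₁ _) = covers p
    c (inj₂ _) (inj₂ _) = covers p′
    d : ∀ {i j} u v → _~_ (F i ⊕ F′ i) u v → _~_ (F j ⊕ F′ j) u v → i ≡ j
    d (inj₁ _) (inj₁ _) = disjoint p
    d (inj₂ _) (inj₂ _) = disjoint p′

  module _ {G H U : SimpleGraph V}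
    (left    : ∀ {u v} → _~_ G u v → _~_ U u v)
    (right   : ∀ {u v} → _~_ H u v → _~_ U u v)
    (split   : ∀ {u v} → _~_ U u v → _~_ G u v ⊎ _~_ H u v)
    (exclude : ∀ {u v} → _~_ G u v → ¬ _~_ H u v) where

    -- On a common vertex set the colours must be kept apart: the first `k` serve `G` and the last
    -- `l` serve `H`. Disjointness between the two blocks is `exclude`.
    union-partition : ∀ {k l} → ForestPartition G k → ForestPartition H l →
                      ForestPartition U (k + l)
    union-partition {k} {l} (F , f , p) (F′ , f′ , p′) = K ∘ splitAt k , forest ∘ splitAt k , record
      { within   = λ {i} → w (splitAt k i)
      ; covers   = λ {u} {v} e → cov e
      ; disjoint = λ {i} {j} a b → splitAt-injective (d (splitAt k i) (splitAt k j) a b)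
      }
      where
      K : Fin k ⊎ Fin l → SimpleGraph V
      K = [ F , F′ ]′
      forest : ∀ s → IsForest (K s)
      forest = [ f , f′ ]
      w : ∀ s {u v} → _~_ (K s) u v → _~_ U u v
      w (inj₁ i) = left ∘ within p
      w (inj₂ i) = right ∘ within p′
      d : ∀ s t {u v} → _~_ (K s) u v → _~_ (K t) u v → s ≡ t
      d (inj₁ i) (inj₁ j) a b = cong inj₁ (disjoint p a b)
      d (inj₁ i) (inj₂ j) a b = contradiction (within p′ b) (exclude (within p a))
      d (inj₂ i) (inj₁ j) a b = contradiction (within p′ a) (exclude (within p b))
      d (inj₂ i) (inj₂ j) a b = cong inj₂ (disjoint p′ a b)
      splitAt-injective : ∀ {i j} → splitAt k {l} i ≡ splitAt k j → i ≡ j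
      splitAt-injective {i} {j} eq =
        trans (sym (Fin.join-splitAt k l i)) (trans (cong (Fin.join k l) eq) (Fin.join-splitAt k l j))
      cov : ∀ {u v} → _~_ U u v → ∃[ i ] _~_ (K (splitAt k i)) u v
      cov {u} {v} e with split e
      ... | inj₁ g = let i , a = covers p g in
        i ↑ˡ l , subst (λ s → _~_ (K s) u v) (sym (Fin.splitAt-↑ˡ k i l)) a
      ... | inj₂ h = let i , a = covers p′ h in
        k ↑ʳ i , subst (λ s → _~_ (K s) u v) (sym (Fin.splitAt-↑ʳ k l i)) a

  empty : SimpleGraph V
  empty ._~_ _ _ = ⊥
  empty .~-sym ()
  empty .~-irrefl _ ()
  empty ._~?_ _ _ = no id

  empty-partition : ∀ k → ForestPartition (empty {V}) k
  empty-partition k = (λ _ → empty) , (λ { _ _ [] (() , _) ; _ _ (_ ∷ _) (_ , _ , () ∷ _) }) , record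
    { within = λ () ; covers = λ () ; disjoint = λ () }

  -- Classes of a partition may be empty, so `l ∸ k` edgeless forests can be added.
  ForestPartition-mono : ∀ {G : SimpleGraph V} {k l} → k ≤ l →
                         ForestPartition G k → ForestPartition G l
  ForestPartition-mono {G = G} {k} {l} k≤l p = subst (ForestPartition G) (ℕ.m+[n∸m]≡n k≤l)
    (union-partition {G = G} {empty} {G} id (λ ()) inj₁ (λ _ ()) p (empty-partition (l ∸ k)))

  -- The number of edges of a forest.

  trail : ∀ {R : Rel V 0ℓ} {u v} → Star R u v → List V
  trail ε = []
  trail (_◅_ {j = w} _ p) = w ∷ trail p

  module _ (_≟_ : Decidable {A = V} _≡_) where

    open DecMembership _≟_ using (_∈?_)

    module _ {R : Rel V 0ℓ} where

      suffix : ∀ {u v w} (p : Star R w v) → Unique (w ∷ trail p) → u ∈ w ∷ trail p →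
               ∃[ q ] Unique (u ∷ trail {u = u} {v} q)
      suffix p uniq (here refl) = p , uniq
      suffix (_ ◅ p) (_ ∷ uniq) (there u∈) = suffix p uniq u∈

      -- Loop erasure: edges are prepended one at a time, and when the new vertex already lies on
      -- the path, everything before that occurrence is dropped.
      simplePath : ∀ {u v} → Star R u v → ∃[ q ] Unique (u ∷ trail {u = u} {v} q)
      simplePath ε = ε , [] ∷ []
      simplePath {u} (_◅_ {j = w} r p) with simplePath p
      ... | q , uniq with u ∈? w ∷ trail q
      ...   | yes u∈ = suffix q uniq u∈
      ...   | no  u∉ = r ◅ q , All.¬Any⇒All¬ _ u∉ ∷ uniq

    module _ {G : SimpleGraph V} {R : Rel V 0ℓ} (R⇒G : R ⇒ _~_ G) where

      trail-linked : ∀ {u v w} (p : Star R u v) → _~_ G v w → Linked (_~_ G) (u ∷ trail p ∷ʳ w)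
      trail-linked ε       vw = vw ∷ [-]
      trail-linked (r ◅ p) vw = R⇒G r ∷ trail-linked p vw

      forest⇒no-detour : IsForest G → ∀ {u v} → _~_ G u v → ¬ R u v → ¬ Star R u v
      forest⇒no-detour forest {u} uv ¬r p with simplePath p
      ... | ε , _ = ~-irrefl G refl uv
      ... | r ◅ ε , _ = ¬r r
      -- A simple path of at least two edges is closed to a cycle by the edge from `v` to `u`. As in
      -- `IsCycle`, `trail` leaves out the starting vertex.
      ... | q@(_ ◅ _ ◅ _) , uniq =
        forest u (trail q) (s≤s (s≤s z≤n) , uniq , trail-linked q (~-sym G uv))

  EdgeOf : List (V × V) → Rel V 0ℓ
  EdgeOf es u v = (u , v) ∈ es ⊎ (v , u) ∈ es

  DistinctEdges : Rel (V × V) 0ℓ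
  DistinctEdges (u , v) e = (u , v) ≢ e × (v , u) ≢ e

  module _ {n} (e : V ↔ Fin n) (G : SimpleGraph V) (forest : IsForest G) where

    -- The classes of `label` are connected by `es`, so `c` is an upper bound on the number of
    -- components.
    Component : List (V × V) → ℕ → Set
    Component es c = Σ (V → Fin c) λ label →
      ∀ {u v} → label u ≡ label v → Star (EdgeOf es) u v

    merge : ∀ {es c u v} → Component es c → _~_ G u v → ¬ Star (EdgeOf es) u v →
            ∃[ c′ ] c ≡ suc c′ × Component ((u , v) ∷ es) c′
    merge {c = zero} {u} (label , _) _ _ with () ← label u
    merge {es} {suc c} {u} {v} (label , joined) uv ¬p = c , refl , label′ , joined′
      where
      v≢u : label v ≢ label u
      v≢u eq = ¬p (joined (sym eq))
      -- The class of `v` takes over the label of `u`; `punchOut` then closes the gap left by the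
      -- old label of `v`.
      label′ : V → Fin c
      label′ w with label v Fin.≟ label w
      ... | yes _ = punchOut v≢u
      ... | no v≢w = punchOut v≢w
      weaken : ∀ {x y} → Star (EdgeOf es) x y → Star (EdgeOf ((u , v) ∷ es)) x y
      weaken = Star.map (Sum.map there there)
      joined′ : ∀ {x y} → label′ x ≡ label′ y → Star (EdgeOf ((u , v) ∷ es)) x y
      joined′ {x} {y} eq with label v Fin.≟ label x | label v Fin.≟ label y
      ... | yes v≡x | yes v≡y = weaken (joined (trans (sym v≡x) v≡y))
      -- Here `y` carries the label of `u`, so the walk goes from `x` to `v`, across the new edge to
      -- `u`, and on to `y`.
      ... | yes v≡x | no  v≢y =
        weaken (joined (sym v≡x)) ◅◅ inj₂ (here refl) ◅
        weaken (joined (Fin.punchOut-injective v≢u v≢y eq))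
      ... | no  v≢x | yes v≡y =
        weaken (joined (Fin.punchOut-injective v≢x v≢u eq)) ◅◅ inj₁ (here refl) ◅
        weaken (joined v≡y)
      ... | no  v≢x | no  v≢y = weaken (joined (Fin.punchOut-injective v≢x v≢y eq))

    -- At first every vertex has its own label. Each further edge joins two vertices not yet
    -- connected, as a detour would close a cycle, and so uses up exactly one label.
    components : ∀ es → AllPairs DistinctEdges es → All (λ (u , v) → _~_ G u v) es →
                 ∃[ c ] length es + c ≡ n × Component es c
    components [] _ _ = n , refl , Inverse.to e , λ {u} {v} eq →
      subst (Star (EdgeOf []) u) (Search.to-injective e eq) ε
    components ((u , v) ∷ es) (new ∷ distinct) (uv ∷ edges)
      with components es distinct edges
    ... | c , eq , comp
      with merge comp uv (forest⇒no-detour (Search._≟_ e) {G = G} R⇒G forest uv ¬uv∈)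
      where
      R⇒G : EdgeOf es ⇒ _~_ G
      R⇒G (inj₁ xy∈) = All.lookup edges xy∈
      R⇒G (inj₂ yx∈) = ~-sym G (All.lookup edges yx∈)
      ¬uv∈ : ¬ EdgeOf es u v
      ¬uv∈ (inj₁ uv∈) = proj₁ (All.lookup new uv∈) refl
      ¬uv∈ (inj₂ vu∈) = proj₂ (All.lookup new vu∈) refl
    ... | c′ , refl , comp′ = c′ , trans (sym (ℕ.+-suc (length es) c′)) eq , comp′

    -- By `components`, the edges and the remaining labels add up to `n`; the label of `v` shows
    -- that at least one remains.
    forest-edges : V → ∀ es → AllPairs DistinctEdges es → All (λ (u , v) → _~_ G u v) es →
                   length es ≤ n ∸ 1
    forest-edges v es distinct edges with components es distinct edges
    ... | zero , _ , label , _ with () ← label v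
    ... | suc c , refl , _ rewrite ℕ.+-suc (length es) c = ℕ.m≤m+n (length es) c

  -- Counting the cross edges of a join.

  length-filter-¬ : ∀ {A : Set} {P : Pred A 0ℓ} (P? : Decidable₁ P) xs →
                    length xs ≡ length (filter P? xs) + length (filter (¬? ∘ P?) xs)
  length-filter-¬ P? [] = refl
  length-filter-¬ P? (x ∷ xs) with P? x
  ... | yes _ = cong suc (length-filter-¬ P? xs)
  ... | no _ = trans (cong suc (length-filter-¬ P? xs)) (sym (ℕ.+-suc _ _))

  module _ {A : Set} {R : Rel A 0ℓ} (colour : A → ℕ) (N : ℕ)
    (bounded : ∀ i xs → AllPairs R xs → All (λ x → colour x ≡ i) xs → length xs ≤ N) where

    length≤colours*bound : ∀ k xs → AllPairs R xs → All (λ x → colour x < k) xs →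
                           length xs ≤ k * N
    length≤colours*bound zero [] _ _ = z≤n
    length≤colours*bound zero (_ ∷ _) _ (() ∷ _)
    length≤colours*bound (suc k) xs pairs small = begin
      length xs                                        ≡⟨ length-filter-¬ P? xs ⟩
      length (filter P? xs) + length (filter ¬P? xs)
        ≤⟨ ℕ.+-mono-≤
             (bounded k (filter P? xs) (AllPairs.filter⁺ P? pairs) (All.all-filter P? xs))
             (length≤colours*bound k (filter ¬P? xs) (AllPairs.filter⁺ ¬P? pairs)
               (All.zipWith (λ (≤k , ≢k) → ℕ.≤∧≢⇒< (s≤s⁻¹ ≤k) ≢k)
                 (All.filter⁺ ¬P? small , All.all-filter ¬P? xs))) ⟩
      N + k * N                                        ∎
      where
      open ℕ.≤-Reasoning
      P? = λ x → colour x ℕ.≟ k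
      ¬P? = ¬? ∘ P?

  -- The cross edges are indexed by `Fin (n₁ * n₂)` through `remQuot` and coloured by the forest
  -- containing them. One colour consists of distinct edges of one forest on `n₁ + n₂` vertices,
  -- which `forest-edges` bounds.
  cross-edges≤ : ∀ (G₁ G₂ : FiniteGraph) .{{_ : NonZero (FiniteGraph.order G₁)}} {k} →
    let n₁ = FiniteGraph.order G₁; n₂ = FiniteGraph.order G₂ in
    ForestPartition (FiniteGraph.graph (join G₁ G₂)) k →
    n₁ * n₂ ≤ k * (n₁ + n₂ ∸ 1)
  cross-edges≤ G₁ G₂ {k} (F , forest , p) = subst (_≤ k * (n₁ + n₂ ∸ 1)) (length-tabulate id)
    (length≤colours*bound colour (n₁ + n₂ ∸ 1) bounded k (allFin (n₁ * n₂))
       (Unique.allFin⁺ (n₁ * n₂)) (All.tabulate⁺ λ x → Fin.toℕ<n (proj₁ (covers p {u x} {v x} _))))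
    where
    open FiniteGraph G₁ renaming (order to n₁; enum to e₁)
    open FiniteGraph G₂ renaming (order to n₂; enum to e₂)
    e = FiniteGraph.enum (join G₁ G₂)
    u v : Fin (n₁ * n₂) → FiniteGraph.Vertex (join G₁ G₂)
    u x = inj₁ (Inverse.from e₁ (proj₁ (remQuot {n₁} n₂ x)))
    v x = inj₂ (Inverse.from e₂ (proj₂ (remQuot {n₁} n₂ x)))
    colour : Fin (n₁ * n₂) → ℕ
    colour x = toℕ (proj₁ (covers p {u x} {v x} _))
    from-injective : ∀ {V n} (e : V ↔ Fin n) {i j} → Inverse.from e i ≡ Inverse.from e j → i ≡ j
    from-injective e {i} {j} eq =
      trans (sym (Inverse.strictlyInverseˡ e i))
        (trans (cong (Inverse.to e) eq) (Inverse.strictlyInverseˡ e j))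
    uv-injective : ∀ {x y} → (u x , v x) ≡ (u y , v y) → x ≡ y
    uv-injective {x} {y} eq = begin
      x                                              ≡⟨ Fin.combine-remQuot {n₁} n₂ x ⟨
      combine (proj₁ (remQuot {n₁} n₂ x)) (proj₂ (remQuot {n₁} n₂ x))
        ≡⟨ cong₂ combine (from-injective e₁ (inj₁-injective (cong proj₁ eq)))
                         (from-injective e₂ (inj₂-injective (cong proj₂ eq))) ⟩
      combine (proj₁ (remQuot {n₁} n₂ y)) (proj₂ (remQuot {n₁} n₂ y))
        ≡⟨ Fin.combine-remQuot {n₁} n₂ y ⟩
      y ∎
      where open ≡-Reasoning
    bounded : ∀ i xs → Unique xs → All (λ x → colour x ≡ i) xs → length xs ≤ n₁ + n₂ ∸ 1
    bounded _ [] _ _ = z≤n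
    -- The head `x` supplies the forest `F i` and also the vertex that `forest-edges` asks for.
    bounded _ xs@(x ∷ _) uniq same@(refl ∷ _) = subst (_≤ n₁ + n₂ ∸ 1) (length-map _ xs)
      (forest-edges e (F i) (forest i) (u x) (map (λ y → u y , v y) xs)
        (AllPairs.map⁺ (AllPairs.map (λ y≢z → y≢z ∘ uv-injective , λ ()) uniq))
        (All.map⁺ (All.map in-Fᵢ same)))
      where
      i = proj₁ (covers p {u x} {v x} _)
      in-Fᵢ : ∀ {y} → colour y ≡ toℕ i → _~_ (F i) (u y) (v y)
      in-Fᵢ {y} eq = subst (λ j → _~_ (F j) (u y) (v y)) (Fin.toℕ-injective eq)
        (proj₂ (covers p {u y} {v y} _))

  -- Arithmetic of the staircase colouring.

  module Staircase (a d n₁ n₂ : ℕ) .{{_ : NonZero n₁}}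
    (n₁≡a+d : n₁ ≡ a + d) (room : n₂ * d + a ≤ a * n₁) where

    -- For `r < n₁` and `c < n₂` this reduces `a r - c d` modulo the period `a n₁` and divides by
    -- `n₁`; the second case adds one period to a negative difference.
    colour : ℕ → ℕ → ℕ
    colour r c with c * d ≤? a * r
    ... | yes _ = (a * r ∸ c * d) / n₁
    ... | no  _ = (a * (r + n₁) ∸ c * d) / n₁

    -- The representative x of r modulo n₁ with i n₁ ≤ a x < i n₁ + a n₁; the two
    -- cases suffice for i < a.
    shift : ℕ → ℕ → ℕ
    shift i r with i * n₁ ≤? a * r
    ... | yes _ = r
    ... | no  _ = r + n₁

    shift-injective : ∀ i {r s} → r < n₁ → s < n₁ → shift i r ≡ shift i s → r ≡ s
    shift-injective i {r} {s} r< s< eq with i * n₁ ≤? a * r | i * n₁ ≤? a * s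
    ... | yes _ | yes _ = eq
    ... | yes _ | no  _ = contradiction eq (ℕ.<⇒≢ (ℕ.<-≤-trans r< (ℕ.m≤n+m n₁ s)))
    ... | no  _ | yes _ = contradiction (sym eq) (ℕ.<⇒≢ (ℕ.<-≤-trans s< (ℕ.m≤n+m n₁ r)))
    ... | no  _ | no  _ = ℕ.+-cancelʳ-≡ n₁ r s eq

    InStep : ℕ → ℕ → ℕ → Set
    InStep i c x = i * n₁ + c * d ≤ a * x × a * x < i * n₁ + c * d + n₁

    quotient-bounds : ∀ {z t} → t ≤ z →
      (z ∸ t) / n₁ * n₁ + t ≤ z × z < (z ∸ t) / n₁ * n₁ + t + n₁
    quotient-bounds {z} {t} t≤z = lower , upper
      where
      open ℕ.≤-Reasoning
      q = (z ∸ t) / n₁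
      r = (z ∸ t) % n₁
      lower : q * n₁ + t ≤ z
      lower = begin
        q * n₁ + t ≤⟨ ℕ.+-monoˡ-≤ t (m/n*n≤m (z ∸ t) n₁) ⟩
        z ∸ t + t  ≡⟨ ℕ.m∸n+n≡m t≤z ⟩
        z          ∎
      upper : z < q * n₁ + t + n₁
      upper = begin-strict
        z                ≡⟨ ℕ.m∸n+n≡m t≤z ⟨
        z ∸ t + t        ≡⟨ cong (_+ t) (m≡m%n+[m/n]*n (z ∸ t) n₁) ⟩
        r + q * n₁ + t   ≡⟨ ring r (q * n₁) t ⟩
        q * n₁ + t + r   <⟨ ℕ.+-monoʳ-< (q * n₁ + t) (m%n<n (z ∸ t) n₁) ⟩
        q * n₁ + t + n₁  ∎
        where
        ring : ∀ r s t → r + s + t ≡ s + t + r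
        ring = solve-∀

    module _ {r c} (r< : r < n₁) (c< : c < n₂) where

      open ℕ.≤-Reasoning

      -- From `room` and `c + 1 ≤ n₂`: the offset of a column stays a full block of length `n₁`
      -- short of the period `a n₁`.
      cd+n₁≤an₁ : c * d + n₁ ≤ a * n₁
      cd+n₁≤an₁ = begin
        c * d + n₁       ≡⟨ cong (c * d +_) n₁≡a+d ⟩
        c * d + (a + d)  ≡⟨ ring a c d ⟩
        suc c * d + a    ≤⟨ ℕ.+-monoˡ-≤ a (ℕ.*-monoˡ-≤ d c<) ⟩
        n₂ * d + a       ≤⟨ room ⟩
        a * n₁           ∎
        where
        ring : ∀ a c d → c * d + (a + d) ≡ (1 + c) * d + a
        ring = solve-∀

      instance
        a-nonZero : NonZero a
        a-nonZero = >-nonZero $ ℕ.*-cancelʳ-< n₁ 0 a $ begin-strict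
          0           <⟨ ℕ.m<n⇒0<n r< ⟩
          n₁          ≤⟨ ℕ.m≤n+m n₁ (c * d) ⟩
          c * d + n₁  ≤⟨ cd+n₁≤an₁ ⟩
          a * n₁      ∎

      cd≤ar+an₁ : c * d ≤ a * (r + n₁)
      cd≤ar+an₁ = begin
        c * d         ≤⟨ ℕ.m+n≤o⇒m≤o (c * d) cd+n₁≤an₁ ⟩
        a * n₁        ≤⟨ ℕ.*-monoʳ-≤ a (ℕ.m≤n+m n₁ r) ⟩
        a * (r + n₁)  ∎

      colour-small : colour r c < a
      colour-small with c * d ≤? a * r
      ... | yes cd≤ = ℕ.*-cancelʳ-< n₁ _ a $ begin-strict
        (a * r ∸ c * d) / n₁ * n₁  ≤⟨ ℕ.m+n≤o⇒m≤o _ (proj₁ (quotient-bounds cd≤)) ⟩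
        a * r                      <⟨ ℕ.*-monoʳ-< a r< ⟩
        a * n₁                     ∎
      -- The added period is compensated by `a r < c d`.
      ... | no cd≰ = ℕ.*-cancelʳ-< n₁ _ a $ ℕ.+-cancelʳ-< (c * d) _ _ $ begin-strict
        (a * (r + n₁) ∸ c * d) / n₁ * n₁ + c * d  ≤⟨ proj₁ (quotient-bounds cd≤ar+an₁) ⟩
        a * (r + n₁)      ≡⟨ ring a r n₁ ⟩
        a * n₁ + a * r    <⟨ ℕ.+-monoʳ-< (a * n₁) (ℕ.≰⇒> cd≰) ⟩
        a * n₁ + c * d    ∎
        where
        ring : ∀ a r m → a * (r + m) ≡ a * m + a * r
        ring = solve-∀

      unshifted : ∀ i → i * n₁ ≤ a * r → InStep i c r → InStep i c (shift i r)
      unshifted i in₁≤ step with i * n₁ ≤? a * r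
      ... | yes _ = step
      ... | no ≰ = contradiction in₁≤ ≰

      shifted : ∀ i → a * r < i * n₁ → InStep i c (r + n₁) → InStep i c (shift i r)
      shifted i <in₁ step with i * n₁ ≤? a * r
      ... | yes in₁≤ = contradiction in₁≤ (ℕ.<⇒≱ <in₁)
      ... | no _ = step

      -- The case distinctions of `colour` and `shift` agree. Without wrapping,
      -- `i n₁ ≤ i n₁ + c d ≤ a r`; with wrapping, the upper end of the interval and `cd+n₁≤an₁`
      -- give `a r < i n₁`.
      colour-inStep : InStep (colour r c) c (shift (colour r c) r)
      colour-inStep with c * d ≤? a * r
      ... | yes cd≤ = unshifted ((a * r ∸ c * d) / n₁)
          (ℕ.m+n≤o⇒m≤o _ (proj₁ (quotient-bounds cd≤))) (quotient-bounds cd≤)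
      ... | no _ = shifted q (ℕ.+-cancelʳ-< (c * d + n₁) _ _ $ begin-strict
          a * r + (c * d + n₁)  ≤⟨ ℕ.+-monoʳ-≤ (a * r) cd+n₁≤an₁ ⟩
          a * r + a * n₁        ≡⟨ ℕ.*-distribˡ-+ a r n₁ ⟨
          a * (r + n₁)          <⟨ proj₂ bounds ⟩
          q * n₁ + c * d + n₁   ≡⟨ ℕ.+-assoc (q * n₁) (c * d) n₁ ⟩
          q * n₁ + (c * d + n₁) ∎) bounds
        where
        q = (a * (r + n₁) ∸ c * d) / n₁
        bounds : InStep q c (r + n₁)
        bounds = quotient-bounds cd≤ar+an₁

    -- The next column starts `d` later, so an interval of length `n₁ = a + d` ends exactly `a`
    -- after the start of the next one.
    later-column : ∀ i {c c′ x} → c < c′ → i * n₁ + c′ * d + a ≤ a * x →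
                   i * n₁ + c * d + n₁ ≤ a * x
    later-column i {c} {c′} {x} c<c′ low = begin
      i * n₁ + c * d + n₁       ≡⟨ cong (i * n₁ + c * d +_) n₁≡a+d ⟩
      i * n₁ + c * d + (a + d)  ≡⟨ ring (i * n₁) a c d ⟩
      i * n₁ + suc c * d + a    ≤⟨ ℕ.+-monoˡ-≤ a (ℕ.+-monoʳ-≤ (i * n₁) (ℕ.*-monoˡ-≤ d c<c′)) ⟩
      i * n₁ + c′ * d + a       ≤⟨ low ⟩
      a * x                     ∎
      where
      open ℕ.≤-Reasoning
      ring : ∀ b a c d → b + c * d + (a + d) ≡ b + (1 + c) * d + a
      ring = solve-∀

    -- Without their first stretch of length `a`, the intervals have length `d`, the distance
    -- between consecutive starts, and are therefore disjoint.
    column-unique : ∀ i {c c′ x} → i * n₁ + c * d + a ≤ a * x → i * n₁ + c′ * d + a ≤ a * x →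
                    InStep i c x → InStep i c′ x → c ≡ c′
    column-unique i {c} {c′} low low′ (_ , up) (_ , up′) with ℕ.<-cmp c c′
    ... | tri≈ _ c≡c′ _ = c≡c′
    ... | tri< c<c′ _ _ = contradiction (later-column i c<c′ low′) (ℕ.<⇒≱ up)
    ... | tri> _ _ c>c′ = contradiction (later-column i c>c′ low) (ℕ.<⇒≱ up′)

    earlier-row : ∀ {t x y} → t ≤ a * x → x < y → t + a ≤ a * y
    earlier-row {t} {x} {y} t≤ax x<y = begin
      t + a      ≤⟨ ℕ.+-monoˡ-≤ a t≤ax ⟩
      a * x + a  ≡⟨ ℕ.+-comm (a * x) a ⟩
      a + a * x  ≡⟨ ℕ.*-suc a x ⟨
      a * suc x  ≤⟨ ℕ.*-monoʳ-≤ a x<y ⟩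
      a * y      ∎
      where open ℕ.≤-Reasoning

    -- A half-open window of length `a` contains at most one multiple of `a`.
    row-unique : ∀ {t x y} → t ≤ a * x → t ≤ a * y → a * x < t + a → a * y < t + a → x ≡ y
    row-unique {x = x} {y} t≤ax t≤ay ax< ay< with ℕ.<-cmp x y
    ... | tri≈ _ x≡y _ = x≡y
    ... | tri< x<y _ _ = contradiction (earlier-row t≤ax x<y) (ℕ.<⇒≱ ay<)
    ... | tri> _ _ x>y = contradiction (earlier-row t≤ay x>y) (ℕ.<⇒≱ ax<)

  -- Splitting the complete bipartite graph into forests.

  bipartite : (P : V₁ → V₂ → Set) → (∀ u v → Dec (P u v)) → SimpleGraph (V₁ ⊎ V₂)
  bipartite P P? ._~_ (inj₁ u) (inj₂ v) = P u v
  bipartite P P? ._~_ (inj₂ v) (inj₁ u) = P u v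
  bipartite P P? ._~_ _        _        = ⊥
  bipartite P P? .~-sym {inj₁ _} {inj₂ _} p = p
  bipartite P P? .~-sym {inj₂ _} {inj₁ _} p = p
  bipartite P P? .~-irrefl {inj₁ _} refl ()
  bipartite P P? .~-irrefl {inj₂ _} refl ()
  bipartite P P? ._~?_ (inj₁ _) (inj₁ _) = no λ ()
  bipartite P P? ._~?_ (inj₁ u) (inj₂ v) = P? u v
  bipartite P P? ._~?_ (inj₂ v) (inj₁ u) = P? u v
  bipartite P P? ._~?_ (inj₂ _) (inj₂ _) = no λ ()

  completeBipartite : SimpleGraph (V₁ ⊎ V₂)
  completeBipartite = bipartite (λ _ _ → ⊤) (λ _ _ → yes tt)

  even≤odd : ∀ {p q} → 2 * p ≤ suc (2 * q) → p ≤ q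
  even≤odd {p} {q} le = s≤s⁻¹ $ ℕ.*-cancelˡ-< 2 p (suc q) $ begin-strict
    2 * p          ≤⟨ le ⟩
    suc (2 * q)    <⟨ ℕ.n<1+n _ ⟩
    2 + 2 * q      ≡⟨ ℕ.*-suc 2 q ⟨
    2 * suc q      ∎
    where open ℕ.≤-Reasoning

  module _ {n₁ n₂} (e₁ : V₁ ↔ Fin n₁) (e₂ : V₂ ↔ Fin n₂) where

    private
      row : V₁ → ℕ
      row = toℕ ∘ Inverse.to e₁

      column : V₂ → ℕ
      column = toℕ ∘ Inverse.to e₂

    module _ {a d} .{{_ : NonZero n₁}} (n₁≡a+d : n₁ ≡ a + d) (room : n₂ * d + a ≤ a * n₁) where

      open Staircase a d n₁ n₂ n₁≡a+d room

      private
        colour′ : V₁ → V₂ → ℕ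
        colour′ u v = colour (row u) (column v)

        small : ∀ u v → colour′ u v < a
        small u v = colour-small (Fin.toℕ<n (Inverse.to e₁ u)) (Fin.toℕ<n (Inverse.to e₂ v))

        lift : ℕ → V₁ → ℕ
        lift i u = shift i (row u)

        start : ℕ → V₂ → ℕ
        start i v = i * n₁ + column v * d

        inStep : ∀ {i} u v → colour′ u v ≡ i → InStep i (column v) (lift i u)
        inStep u v refl =
          colour-inStep (Fin.toℕ<n (Inverse.to e₁ u)) (Fin.toℕ<n (Inverse.to e₂ v))

      colourClass : ℕ → SimpleGraph (V₁ ⊎ V₂)
      colourClass i = bipartite (λ u v → colour′ u v ≡ i) (λ u v → colour′ u v ℕ.≟ i)

      -- A row precedes the columns whose interval starts at it or later; the
      -- doubling turns a x < start + a into a strict comparison without ties.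
      rank : ℕ → V₁ ⊎ V₂ → ℕ
      rank i (inj₁ u) = suc (2 * (a * lift i u))
      rank i (inj₂ v) = 2 * (start i v + a)

      colourClass-isForest : ∀ i → IsForest (colourClass i)
      colourClass-isForest i = rank⇒forest (colourClass i) (rank i) (λ {u} {v} {w} → lower u v w)
        where
        lower : ∀ u v w → _~_ (colourClass i) u v → _~_ (colourClass i) u w →
                rank i v ≤ rank i u → rank i w ≤ rank i u → v ≡ w
        -- A column ranked no higher than the row `u` satisfies `start + a ≤ a x`, the range in
        -- which intervals of distinct columns are disjoint.
        lower (inj₁ u) (inj₂ v) (inj₂ w) uv uw v≤u w≤u = cong inj₂ $
          Search.to-injective e₂ $ Fin.toℕ-injective $
          column-unique i (even≤odd v≤u) (even≤odd w≤u) (inStep u v uv) (inStep u w uw)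
        -- A row ranked no higher than the column `u` has `a x` in the first stretch of length `a`
        -- of its interval.
        lower (inj₂ u) (inj₁ v) (inj₁ w) uv uw v≤u w≤u = cong inj₁ $
          Search.to-injective e₁ $ Fin.toℕ-injective $
          shift-injective i (Fin.toℕ<n _) (Fin.toℕ<n _) $
          row-unique (proj₁ (inStep v u uv)) (proj₁ (inStep w u uw))
            (ℕ.*-cancelˡ-< 2 _ _ v≤u) (ℕ.*-cancelˡ-< 2 _ _ w≤u)

      colour-partition : ForestPartition completeBipartite a
      colour-partition = colourClass ∘ toℕ , colourClass-isForest ∘ toℕ , record
        { within   = λ {i} {u} {v} → w u v
        ; covers   = λ {u} {v} → c u v
        ; disjoint = λ {i} {j} {u} {v} → dis u v
        }
        where
        w : ∀ {i} u v → _~_ (colourClass i) u v → _~_ completeBipartite u v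
        w (inj₁ _) (inj₂ _) _ = tt
        w (inj₂ _) (inj₁ _) _ = tt
        c : ∀ u v → _~_ completeBipartite u v → ∃[ i ] _~_ (colourClass (toℕ {a} i)) u v
        c (inj₁ u) (inj₂ v) _ = fromℕ< (small u v) , sym (Fin.toℕ-fromℕ< (small u v))
        c (inj₂ v) (inj₁ u) _ = fromℕ< (small u v) , sym (Fin.toℕ-fromℕ< (small u v))
        dis : ∀ {i j : Fin a} u v → _~_ (colourClass (toℕ i)) u v → _~_ (colourClass (toℕ j)) u v → i ≡ j
        dis (inj₁ _) (inj₂ _) p q = Fin.toℕ-injective (trans (sym p) q)
        dis (inj₂ _) (inj₁ _) p q = Fin.toℕ-injective (trans (sym p) q)

  -- Bounds for the arboricity of a join.

  join-partition : ∀ {G₁ : SimpleGraph V₁} {G₂ : SimpleGraph V₂} {k l} →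
                   ForestPartition (G₁ ⊕ G₂) k → ForestPartition completeBipartite l →
                   ForestPartition (joinSimple G₁ G₂) (k + l)
  join-partition {V₁} {V₂} {G₁} {G₂} = union-partition
    (λ {u} {v} → l u v) (λ {u} {v} → r u v) (λ {u} {v} → s u v) (λ {u} {v} → x u v)
    where
    l : ∀ u v → _~_ (G₁ ⊕ G₂) u v → JoinAdj G₁ G₂ u v
    l (inj₁ _) (inj₁ _) = id
    l (inj₂ _) (inj₂ _) = id
    r : ∀ u v → _~_ completeBipartite u v → JoinAdj G₁ G₂ u v
    r (inj₁ _) (inj₂ _) = id
    r (inj₂ _) (inj₁ _) = id
    s : ∀ u v → JoinAdj G₁ G₂ u v → _~_ (G₁ ⊕ G₂) u v ⊎ _~_ completeBipartite u v
    s (inj₁ _) (inj₁ _) = inj₁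
    s (inj₂ _) (inj₂ _) = inj₁
    s (inj₁ _) (inj₂ _) = inj₂
    s (inj₂ _) (inj₁ _) = inj₂
    x : ∀ u v → _~_ (G₁ ⊕ G₂) u v → ¬ _~_ completeBipartite u v
    x (inj₁ _) (inj₁ _) _ ()
    x (inj₂ _) (inj₂ _) _ ()

  module _ (G : FiniteGraph) where

    open FiniteGraph G

    forestCount : ℕ
    forestCount = proj₁ (forestNumber G)

    minimumPartition : ForestPartition graph forestCount
    minimumPartition = proj₁ (proj₂ (forestNumber G))

    arb≤ : ∀ {k} → ForestPartition graph k → arb G ≤ k ∸ 1
    arb≤ {k} p = ℕ.∸-monoˡ-≤ 1 (proj₂ (proj₂ (forestNumber G)) k p)

  module _ (G₁ G₂ : FiniteGraph) where

    open FiniteGraph G₁ using () renaming (order to n₁)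
    open FiniteGraph G₂ using () renaming (order to n₂)

    arb≤arb-join₁ : arb G₁ ≤ arb (join G₁ G₂)
    arb≤arb-join₁ = arb≤ G₁ (comap-partition inj₁ inj₁-injective id id (minimumPartition (join G₁ G₂)))

    arb≤arb-join₂ : arb G₂ ≤ arb (join G₁ G₂)
    arb≤arb-join₂ = arb≤ G₂ (comap-partition inj₂ inj₂-injective id id (minimumPartition (join G₁ G₂)))

    -- Together, `large` and `least` characterise `a` as the ceiling of `n₁ n₂ / (n₁ + n₂ - 1)`
    -- without mentioning division.
    module _ .{{_ : NonZero n₁}} {a} (large : n₁ * n₂ ≤ a * (n₁ + n₂ ∸ 1))
      (least : ∀ k → n₁ * n₂ ≤ k * (n₁ + n₂ ∸ 1) → a ≤ k) where

      bound≤arb-join : a ∸ 1 ≤ arb (join G₁ G₂)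
      bound≤arb-join = ℕ.∸-monoˡ-≤ 1
        (least (forestCount (join G₁ G₂)) (cross-edges≤ G₁ G₂ (minimumPartition (join G₁ G₂))))

      open ℕ.≤-Reasoning

      1≤n₁+n₂ : 1 ≤ n₁ + n₂
      1≤n₁+n₂ = ℕ.≤-trans (>-nonZero⁻¹ n₁) (ℕ.m≤m+n n₁ n₂)

      -- The multiplier `n₁` is admissible because `n₂ ≤ n₁ + n₂ - 1`. This makes `n₁ ∸ a` a true
      -- difference, the `d` of the staircase.
      a≤n₁ : a ≤ n₁
      a≤n₁ = least n₁ (ℕ.*-monoʳ-≤ n₁ (ℕ.∸-monoˡ-≤ 1 (ℕ.+-monoˡ-≤ n₂ (>-nonZero⁻¹ n₁))))

      room : n₂ * (n₁ ∸ a) + a ≤ a * n₁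
      -- Adding `a n₂` to both sides turns the claim into `large` with `a` added to both sides.
      room = ℕ.+-cancelʳ-≤ (a * n₂) _ _ $ begin
        n₂ * (n₁ ∸ a) + a + a * n₂    ≡⟨ ring₁ a (n₁ ∸ a) n₂ ⟩
        (a + (n₁ ∸ a)) * n₂ + a       ≡⟨ cong (λ n → n * n₂ + a) (ℕ.m+[n∸m]≡n a≤n₁) ⟩
        n₁ * n₂ + a                   ≤⟨ ℕ.+-monoˡ-≤ a large ⟩
        a * (n₁ + n₂ ∸ 1) + a         ≡⟨ ring₂ a (n₁ + n₂ ∸ 1) ⟩
        a * (1 + (n₁ + n₂ ∸ 1))       ≡⟨ cong (a *_) (ℕ.m+[n∸m]≡n 1≤n₁+n₂) ⟩
        a * (n₁ + n₂)                 ≡⟨ ℕ.*-distribˡ-+ a n₁ n₂ ⟩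
        a * n₁ + a * n₂               ∎
        where
        ring₁ : ∀ a d n → n * d + a + a * n ≡ (a + d) * n + a
        ring₁ = solve-∀
        ring₂ : ∀ a s → a * s + a ≡ a * (1 + s)
        ring₂ = solve-∀

      -- The two sides share `k₁ ⊔ k₂` forests and the cross edges take `a` more.
      arb-join≤ : arb (join G₁ G₂) ≤ arb G₁ + arb G₂ + a
      arb-join≤ = begin
        arb (join G₁ G₂)
          ≤⟨ arb≤ (join G₁ G₂) (join-partition
               (⊕-partition (ForestPartition-mono (ℕ.m≤m⊔n k₁ k₂) (minimumPartition G₁))
                            (ForestPartition-mono (ℕ.m≤n⊔m k₁ k₂) (minimumPartition G₂)))
               (colour-partition (FiniteGraph.enum G₁) (FiniteGraph.enum G₂)
                 (sym (ℕ.m+[n∸m]≡n a≤n₁)) room)) ⟩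
        k₁ ⊔ k₂ + a ∸ 1         ≤⟨ ℕ.∸-monoˡ-≤ 1 (ℕ.+-monoˡ-≤ a (⊔≤ k₁ k₂)) ⟩
        k₁ ∸ 1 + (k₂ ∸ 1) + a   ∎
        where
        k₁ = forestCount G₁
        k₂ = forestCount G₂
        -- For positive arguments the right side is `k + l - 1`. Truncated subtraction keeps the
        -- bound valid at 0, the forest count of an edgeless graph.
        ⊔≤ : ∀ k l → k ⊔ l ≤ 1 + (k ∸ 1 + (l ∸ 1))
        ⊔≤ k l = ℕ.⊔-lub
          (ℕ.≤-trans (ℕ.m≤n+m∸n k 1) (s≤s (ℕ.m≤m+n _ _)))
          (ℕ.≤-trans (ℕ.m≤n+m∸n l 1) (s≤s (ℕ.m≤n+m _ _)))

-- The ceiling of a fraction as a least multiplier.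

module Ceiling where
  open import Data.Integer hiding (_/_; NonZero)
  open import Data.Integer.Properties
  open import Data.Integer.DivMod using ([n/d]*d≤n; n<s[n/ℕd]*d; div-pos-is-/ℕ)
  open import Data.Integer.GCD using (gcd)
  open import Data.Nat as ℕ using (ℕ; NonZero)
  import Data.Nat.Properties as ℕ
  open import Data.Nat.GCD using (gcd[m,n]≢0)
  open import Data.Product using (∃-syntax; _×_; _,_; proj₁; proj₂)
  open import Data.Sum using (inj₂)
  open import Data.Rational as ℚ using (ℚ; ↥_; ↧_; ceiling; floor; _/_)
  open import Data.Rational.Properties using (↥-/; ↧-/; ↥-neg; ↧-neg)
  open import Relation.Binary.PropositionalEquality

  floor-bounds : ∀ q → floor q * ↧ q ≤ ↥ q × ↥ q < suc (floor q) * ↧ q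
  floor-bounds q@record{} =
    [n/d]*d≤n (↥ q) (↧ q) ,
    subst (λ x → ↥ q < suc x * ↧ q) (sym (div-pos-is-/ℕ (↥ q) (ℚ.↧ₙ q))) (n<s[n/ℕd]*d (↥ q) (ℚ.↧ₙ q))

  -- The ceiling of `q` is minus the floor of `- q`, so these are the floor bounds with signs
  -- reversed.
  ceiling-bounds : ∀ q → ↥ q ≤ ceiling q * ↧ q × pred (ceiling q) * ↧ q < ↥ q
  ceiling-bounds q@record{} = lower , upper
    where
    open ≤-Reasoning
    f = floor (ℚ.- q)
    bounds = floor-bounds (ℚ.- q)
    lower : ↥ q ≤ - f * ↧ q
    lower = begin
      ↥ q                   ≡⟨ neg-involutive (↥ q) ⟨
      - (- (↥ q))           ≡⟨ cong -_ (↥-neg q) ⟨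
      - (↥ (ℚ.- q))         ≤⟨ neg-mono-≤ (proj₁ bounds) ⟩
      - (f * ↧ (ℚ.- q))     ≡⟨ cong (λ d → - (f * d)) (↧-neg q) ⟩
      - (f * ↧ q)           ≡⟨ neg-distribˡ-* f (↧ q) ⟩
      - f * ↧ q             ∎
    upper : pred (- f) * ↧ q < ↥ q
    upper = begin-strict
      pred (- f) * ↧ q           ≡⟨ cong (_* ↧ q) (neg-suc′ f) ⟨
      - (suc f) * ↧ q            ≡⟨ neg-distribˡ-* (suc f) (↧ q) ⟨
      - (suc f * ↧ q)            ≡⟨ cong (λ d → - (suc f * d)) (↧-neg q) ⟨
      - (suc f * ↧ (ℚ.- q))      <⟨ neg-mono-< (proj₂ bounds) ⟩
      - (↥ (ℚ.- q))              ≡⟨ cong -_ (↥-neg q) ⟩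
      - (- (↥ q))                ≡⟨ neg-involutive (↥ q) ⟩
      ↥ q                        ∎
      where
      neg-suc′ : ∀ i → - (suc i) ≡ pred (- i)
      neg-suc′ i = neg-distrib-+ 1ℤ i

  module _ (p d : ℕ) .{{_ : NonZero d}} where

    private
      c = ceiling (+ p / d)
      g = gcd (+ p) (+ d)

    instance
      g-positive : Positive g
      g-positive = positive (+<+ (ℕ.n≢0⇒n>0 (gcd[m,n]≢0 p d (inj₂ (ℕ.≢-nonZero⁻¹ d)))))

    open ≤-Reasoning

    -- The rational is stored in lowest terms; multiplying its numerator and denominator by `g`
    -- recovers `p` and `d`.
    ≤ceiling*d : + p ≤ c * + d
    ≤ceiling*d = begin
      + p                    ≡⟨ ↥-/ (+ p) d ⟨
      ↥ (+ p / d) * g        ≤⟨ *-monoʳ-≤-nonNeg g (proj₁ (ceiling-bounds (+ p / d))) ⟩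
      c * ↧ (+ p / d) * g    ≡⟨ *-assoc c _ g ⟩
      c * (↧ (+ p / d) * g)  ≡⟨ cong (c *_) (↧-/ (+ p) d) ⟩
      c * + d                ∎

    pred-ceiling*d< : pred c * + d < + p
    pred-ceiling*d< = begin-strict
      pred c * + d                ≡⟨ cong (pred c *_) (↧-/ (+ p) d) ⟨
      pred c * (↧ (+ p / d) * g)  ≡⟨ *-assoc (pred c) _ g ⟨
      pred c * ↧ (+ p / d) * g    <⟨ *-monoʳ-<-pos g (proj₂ (ceiling-bounds (+ p / d))) ⟩
      ↥ (+ p / d) * g             ≡⟨ ↥-/ (+ p) d ⟩
      + p                         ∎

    -- From `0 ≤ p ≤ c d` the ceiling is a natural number. If `p ≤ k d`, then `(c - 1) d < p` gives
    -- `c - 1 < k`, that is, `c ≤ k`.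
    ceiling-isLeast : ∃[ a ] c ≡ + a × p ℕ.≤ a ℕ.* d × (∀ k → p ℕ.≤ k ℕ.* d → a ℕ.≤ k)
    ceiling-isLeast = ∣ c ∣ , sym +∣c∣≡c ,
      drop‿+≤+ (begin
        + p              ≤⟨ ≤ceiling*d ⟩
        c * + d          ≡⟨ cong (_* + d) +∣c∣≡c ⟨
        + ∣ c ∣ * + d    ≡⟨ pos-* ∣ c ∣ d ⟨
        + (∣ c ∣ ℕ.* d)  ∎) ,
      λ k p≤kd → drop‿+≤+ (begin
        + ∣ c ∣       ≡⟨ +∣c∣≡c ⟩
        c             ≡⟨ suc-pred c ⟨
        suc (pred c)  ≤⟨ i<j⇒suc[i]≤j (*-cancelʳ-<-nonNeg {pred c} {+ k} (+ d) (begin-strict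
          pred c * + d  <⟨ pred-ceiling*d< ⟩
          + p           ≤⟨ +≤+ p≤kd ⟩
          + (k ℕ.* d)   ≡⟨ pos-* k d ⟩
          + k * + d     ∎)) ⟩
        + k           ∎)
      where
      instance
        d-positive : Positive (+ d)
        d-positive = positive (+<+ (ℕ.>-nonZero⁻¹ d))
      +∣c∣≡c : + ∣ c ∣ ≡ c
      +∣c∣≡c = 0≤i⇒+∣i∣≡i (*-cancelʳ-≤-pos 0ℤ c (+ d) (≤-trans (+≤+ ℕ.z≤n) ≤ceiling*d))

  pred-cancel : ∀ i a → i + (+ a - 1ℤ) + 1ℤ ≡ i + + a
  pred-cancel i a = trans (+-assoc i (+ a - 1ℤ) 1ℤ)
    (cong (_+_ i) (trans (+-assoc (+ a) -1ℤ 1ℤ) (+-identityʳ (+ a))))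

  a-1≤a∸1 : ∀ a → + a - 1ℤ ≤ + (a ℕ.∸ 1)
  a-1≤a∸1 ℕ.zero    = -≤+
  a-1≤a∸1 (ℕ.suc _) = ≤-refl

-- Assembling the two inequalities over the integers.

open import Defs
open import Data.Integer using (+_; 1ℤ; _+_; _⊔_; _≤_)
open import Data.Nat using (NonZero)
open import Data.Product using (_×_)
open FiniteGraph using (order)

import Data.Integer as ℤ
import Data.Integer.Properties as ℤ
import Data.Nat as ℕ
open import Data.Product using (_,_; proj₁; proj₂)
open import Relation.Binary.PropositionalEquality using (_≡_; cong)
open ForestPartitions
open Ceiling

theorem23 : (G₁ G₂ : FiniteGraph) .{{_ : NonZero (order G₁)}} .{{_ : NonZero (order G₂)}} →
    (+ arb G₁ ⊔ + arb G₂ ⊔ B (order G₁) (order G₂) ≤ + arb (join G₁ G₂))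
    × (+ arb (join G₁ G₂) ≤ + arb G₁ + + arb G₂ + B (order G₁) (order G₂) + 1ℤ)
theorem23 G₁ G₂ =
  ℤ.⊔-lub
    (ℤ.⊔-lub (ℤ.+≤+ (arb≤arb-join₁ G₁ G₂)) (ℤ.+≤+ (arb≤arb-join₂ G₁ G₂)))
    (begin
      B n₁ n₂             ≡⟨ B≡a-1 ⟩
      + a ℤ.- 1ℤ          ≤⟨ a-1≤a∸1 a ⟩
      + (a ℕ.∸ 1)         ≤⟨ ℤ.+≤+ (bound≤arb-join G₁ G₂ large least′) ⟩
      + arb (join G₁ G₂)  ∎) ,
  (begin
    + arb (join G₁ G₂)                        ≤⟨ ℤ.+≤+ (arb-join≤ G₁ G₂ large least′) ⟩
    -- The final 1 in the upper bound cancels the 1 subtracted in `B`.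
    + arb G₁ + + arb G₂ + + a                 ≡⟨ pred-cancel (+ arb G₁ + + arb G₂) a ⟨
    + arb G₁ + + arb G₂ + (+ a ℤ.- 1ℤ) + 1ℤ
      ≡⟨ cong (λ b → + arb G₁ + + arb G₂ + b + 1ℤ) B≡a-1 ⟨
    + arb G₁ + + arb G₂ + B n₁ n₂ + 1ℤ        ∎)
  where
  open ℤ.≤-Reasoning
  n₁ = order G₁
  n₂ = order G₂
  isLeast = ceiling-isLeast (n₁ ℕ.* n₂) (n₁ ℕ.+ n₂ ℕ.∸ 1) {{order-nonZero n₁ n₂}}
  a = proj₁ isLeast
  large = proj₁ (proj₂ (proj₂ isLeast))
  least′ = proj₂ (proj₂ (proj₂ isLeast))
  B≡a-1 : B n₁ n₂ ≡ + a ℤ.- 1ℤ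
  B≡a-1 = cong (ℤ._- 1ℤ) (proj₁ (proj₂ isLeast))
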